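{- Let $\mathcal{KB}$ be a $\mathcal{DL}_{\mathbf D}^{4,\times}$-knowledge base, let $\phi_{\mathcal{KB}}$ be the set-theoretic formula representing it, and let $\mathcal{T}_{\mathcal{KB}}$ be the KE$^\gamma$-tableau computed by the procedure Consistency on input $\phi_{\mathcal{KB}}$. If $\phi_{\mathcal{KB}}$ is satisfiable, then $\mathcal{T}_{\mathcal{KB}}$ is not closed.
   Context: **Knowledge bases.** Let $\mathbf{D}$ be a data type map: a finite set $N_D$ of data types, for each $d\in N_D$ a set $N_C(d)$ of constants and a set $N_F(d)$ of facets, and interpretations $d^{\mathbf D}$ (nonempty and pairwise disjoint), $f^{\mathbf D}\subseteq d^{\mathbf D}$ for facets, $e_d^{\mathbf D}\in d^{\mathbf D}$ for constants. Given pairwise disjoint denumerable sets of abstract role names $S$ (among them the universal role $U$), concrete role names $T$, concept names $A$ and individual names $a,b$, the terms of the description logic $\mathcal{DL}_{\mathbf D}^{4,\times}$ are: data type terms $t::=dr\mid\neg t\mid t\sqcap t\mid t\sqcup t\mid\{e_d\}$ ($dr$ a data range for $\mathbf D$, $e_d\in N_C(d)$); concept terms $C::=A\mid\top\mid\bot\mid\neg C\mid C\sqcup C\mid C\sqcap C\mid\{a\}\mid\exists R.\mathit{Self}\mid\exists R.\{a\}\mid\exists P.\{e_d\}$; abstract role terms $R::=S\mid U\mid R^{ - }\mid\neg R\mid R\sqcup R\mid R\sqcap R\mid R_{C|}\mid R_{|C}\mid R_{C|C}\mid id(C)\mid C\times C$; concrete role terms $P::=T\mid\neg P\mid P\sqcup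 P\mid P\sqcap P\mid P_{C|}\mid P_{|t}\mid P_{C|t}$. A $\mathcal{DL}_{\mathbf D}^{4,\times}$-knowledge base $\mathcal{KB}$ consists of an RBox, a TBox and an ABox. RBox statements: $R_1\equiv R_2$, $R_1\sqsubseteq R_2$, $R_1\ldots R_n\sqsubseteq R_{n+1}$, $\mathsf{Sym}(R_1)$, $\mathsf{Asym}(R_1)$, $\mathsf{Ref}(R_1)$, $\mathsf{Irref}(R_1)$, $\mathsf{Dis}(R_1,R_2)$, $\mathsf{Tra}(R_1)$, $\mathsf{Fun}(R_1)$, $R_1\equiv C_1\times C_2$, $P_1\equiv P_2$, $P_1\sqsubseteq P_2$, $\mathsf{Dis}(P_1,P_2)$, $\mathsf{Fun}(P_1)$. TBox statements: $C_1\equiv C_2$, $C_1\sqsubseteq C_2$, $C_1\sqsubseteq\forall R_1.C_2$, $\exists R_1.C_1\sqsubseteq C_2$, $\geq_n R_1.C_1\sqsubseteq C_2$, $C_1\sqsubseteq{\leq_n R_1.C_2}$, $t_1\equiv t_2$, $t_1\sqsubseteq t_2$, $C_1\sqsubseteq\forall P_1.t_1$, $\exists P_1.t_1\sqsubseteq C_1$, $\geq_n P_1.t_1\sqsubseteq C_1$, $C_1\sqsubseteq{\leq_n P_1.t_1}$. ABox assertions: $a:C_1$, $(a,b):R_1$, $a=b$, $a\neq b$, $e_d:t_1$, $(a,e_d):P_1$. **Set-theoretic formulae.** There are variables of sort 0 ($x,y,z,\dots$), of sort 1 ($X^1,\dots$) and of sort 3 ($X^3,\dots$). Atomic formulae are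 $x=y$, $x\in X^1$, $\langle x,y\rangle\in X^3$; quantifier-free literals are atomic formulae and their negations. $\overline{A}$ is the complement of a literal $A$ (the negation of $A$ if $A$ is atomic, and $B$ if $A$ is $\neg B$). $\mathsf{Var}_0(\cdot)$ is the set of sort-0 variables occurring free, and $Q\mathsf{Var}_0(\psi)=\{x_1,\dots,x_m\}$ is the set of quantified variables of a purely universal formula $\psi=(\forall x_1)\ldots(\forall x_m)(\beta_1\vee\ldots\vee\beta_n)$, where $x_1,\dots,x_m$ have sort 0 and $\beta_1,\dots,\beta_n$ are quantifier-free literals. Bound variables are named apart from free ones. Substitutions replace free occurrences of variables by variables of the same sort; $\epsilon$ is the empty substitution; $\sigma\cdot\rho$ means first $\sigma$, then $\rho$. **The formula $\phi_{\mathcal{KB}}$.** It is the formula in conjunctive normal form $$\phi_{\mathcal{KB}}:=\bigwedge_{H\in\mathcal{KB}}\theta(H)\wedge\bigwedge_{i=1}^{12}\xi_i,$$ where $\theta$ is the fixed translation function taking each axiom or assertion $H$ of $\mathcal{KB}$ to a set-theoretic formula $\theta(H)$ (individuals and data constants being represented by variables of sort 0, concepts and data types by variables of sort 1, roles by variables of sort 3), and $\xi_1,\dots,\xi_{12}$ are fixed constraints ensuring that each model of $\phi_{\mathcal{KB}}$ can be transformed into an interpretation of the description logic, with disjoint nonempty domains of individuals and of data values. Every conjunct of $\phi_{\mathcal{KB}}$ is a quantifier-free literal or a purely universal formula of the form displayed above; this form is all that the procedure below uses. **Interpretations.** An interpretation is a pair $\mathcal{M}=(D,M)$ with $D\ne\emptyset$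 and $Mx\in D$, $MX^1\in\mathcal{P}(D)$, $MX^3\in\mathcal{P}(\mathcal{P}(\mathcal{P}(D)))$, where $\mathcal P$ is the powerset; pairs are interpreted as $M\langle x,y\rangle=\{\{Mx\},\{Mx,My\}\}$. Literals and propositional connectives are evaluated in the standard way, and $\mathcal{M}\models(\forall z_1)\ldots(\forall z_n)\varphi_0$ iff $\mathcal{M}[\vec z/\vec u]\models\varphi_0$ for all $\vec u\in D^n$. A formula $\varphi$ is satisfiable if $\mathcal{M}\models\varphi$ for some interpretation $\mathcal{M}$ (a model of $\varphi$). **KE$^\gamma$-tableaux.** Let $\Phi_{\mathcal{KB}}$ be the set of conjuncts of $\phi_{\mathcal{KB}}$. A KE$^\gamma$-tableau for $\Phi_{\mathcal{KB}}$ is a tree of formulae obtained from the one-branch tree listing the elements of $\Phi_{\mathcal{KB}}$ by finitely many steps, each of which applies one of the following rules to a branch $\vartheta$, or replaces a branch $\vartheta$ by $\vartheta\sigma$ (a substitution $\sigma$ applied to every formula of $\vartheta$): - E$^\gamma$-rule: if $\psi=(\forall x_1)\ldots(\forall x_m)(\beta_1\vee\ldots\vee\beta_n)$ is in $\vartheta$, $\tau=\{x_1/x_{o_1},\ldots,x_m/x_{o_m}\}$ with $x_{o_1},\dots,x_{o_m}\in\mathsf{Var}_0(\phi_{\mathcal{KB}})$, and all elements of $\mathcal{S}^{\overline\beta\tau}_i:=\{\overline\beta_1\tau,\dots,\overline\beta_n\tau\}\setminus\{\overline\beta_i\tau\}$ are in $\vartheta$, then append $\beta_i\tau$ to $\vartheta$.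 - PB-rule: for a literal $A$, split $\vartheta$ into two branches, appending $A$ to one and $\overline A$ to the other. A branch is closed if it contains both $A$ and $\neg A$ for some formula $A$, or a literal $\neg(x=x)$; otherwise it is open. A tableau is closed if all its branches are closed. A purely universal formula $\psi=(\forall x_1)\ldots(\forall x_m)(\beta_1\vee\ldots\vee\beta_n)$ is fulfilled in $\vartheta$ if for every $\tau:Q\mathsf{Var}_0(\psi)\to\mathsf{Var}_0(\phi_{\mathcal{KB}})$ the branch contains $\beta_i\tau$ for some $i$. A branch is fulfilled if every purely universal formula in it is fulfilled in it. A tableau is fulfilled if each of its branches is fulfilled or closed. **Procedure Consistency($\phi_{\mathcal{KB}}$)** (choices are arbitrary). (1) Start with the one-branch tableau $\mathcal{T}_{\mathcal{KB}}:=\Phi_{\mathcal{KB}}$ and $\mathcal{E}:=\emptyset$. (2) While $\mathcal{T}_{\mathcal{KB}}$ is not fulfilled: select a not fulfilled open branch $\vartheta$ and a formula $\psi=(\forall x_1)\ldots(\forall x_m)(\beta_1\vee\ldots\vee\beta_n)$ in $\vartheta$ not fulfilled in $\vartheta$; for each substitution $\tau$ of $x_1,\dots,x_m$ by elements of $\mathsf{Var}_0(\phi_{\mathcal{KB}})$: if $\beta_i\tau\notin\vartheta$ for every $i$, then (2a) if $\mathcal{S}^{\overline\beta\tau}_j$ is contained in $\vartheta$ for some $j$, apply the E$^\gamma$-rule to $\psi$ and $\mathcal{S}^{\overline\beta\tau}_j$ on $\vartheta$; (2b) otherwise, let $h$ be the least index with $\overline\beta_h\tau\notin\vartheta$ and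 apply the PB-rule with $A=\overline\beta_h\tau$ on $\vartheta$ (either resulting branch may then play the role of $\vartheta$). (3) For each branch $\vartheta$ of $\mathcal{T}_{\mathcal{KB}}$ that is open: set $\sigma_\vartheta:=\epsilon$ and $\mathsf{Eq}_\vartheta:=\{$literals of type $x=y$ occurring in $\vartheta\}$; while $\mathsf{Eq}_\vartheta$ contains some $x=y$ with $x,y$ distinct, select such a literal, let $z$ be the minimum of $x,y$ in a fixed total order on $\mathsf{Var}_0(\phi_{\mathcal{KB}})$, and set $\sigma_\vartheta:=\sigma_\vartheta\cdot\{x/z,y/z\}$ and then $\mathsf{Eq}_\vartheta:=\mathsf{Eq}_\vartheta\sigma_\vartheta$; finally add $(\vartheta,\sigma_\vartheta)$ to $\mathcal{E}$ and replace $\vartheta$ by $\vartheta\sigma_\vartheta$. (4) Return $(\mathcal{T}_{\mathcal{KB}},\mathcal{E})$. -}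

module Defs where

open import Level using (Level; 0ℓ; _⊔_) renaming (suc to lsuc)
open import Algebra.Construct.NaturalChoice.Min using () renaming (_⊓_ to min)
open import Data.Bool.Base using (if_then_else_)
open import Data.Fin.Base using (Fin) renaming (_<_ to _<ᶠ_)
open import Data.List.Base using (List; []; _∷_; [_]; _++_; _∷ʳ_; map; mapMaybe; concatMap; allFin)
open import Data.List.Membership.Propositional using (_∈_; _∉_)
open import Data.List.NonEmpty.Base using (List⁺)
open import Data.List.Relation.Unary.All using (All)
open import Data.List.Relation.Unary.Unique.Propositional using (Unique)
open import Data.Maybe.Base using (Maybe; just; nothing)
open import Data.Nat.Base using (ℕ; suc)
open import Data.Nat.Properties using (_≟_)
open import Data.Product.Base using (Σ; ∃; _×_; _,_)
open import Data.Product.Base as Product using ()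
open import Data.Sum.Base using (_⊎_; inj₁; inj₂; [_,_]′)
open import Data.Sum.Base as Sum using ()
open import Data.Vec.Base as Vec using (Vec)
open import Data.Vec.Relation.Unary.All as VecAll using ()
open import Function.Base using (id; _∘_)
open import Function.Bundles using (_⇔_)
open import Relation.Binary.Bundles using (Setoid; TotalOrder)
open import Relation.Binary.Core using (Rel)
open import Relation.Binary.Definitions using (_Respects_)
open import Relation.Binary.PropositionalEquality using (_≡_; _≢_; setoid)
open import Relation.Binary.Structures using (IsTotalOrder)
open import Relation.Nullary.Decidable.Core using (⌊_⌋; _⊎-dec_)
open import Relation.Nullary.Negation.Core using (¬_)
open import Relation.Unary using (Pred; _⊆_; _≐_)
open import Relation.Unary.Properties using (≐-refl; ≐-sym; ≐-trans)

------------------------------------------------------------------------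
-- Data type maps

record DataTypeMap : Set₁ where
  field
    numTypes : ℕ

  N-D : Set
  N-D = Fin numTypes

  field
    N-C N-F  : N-D → Set
    Value    : Set
    ⟦_⟧ᵈ     : N-D → Pred Value 0ℓ
    ⟦_⟧ᶠ     : ∀ {d} → N-F d → Pred Value 0ℓ
    ⟦_⟧ᶜ     : ∀ {d} → N-C d → Value
    nonempty : ∀ d → ∃ ⟦ d ⟧ᵈ
    disjoint : ∀ {d d′ v} → ⟦ d ⟧ᵈ v → ⟦ d′ ⟧ᵈ v → d ≡ d′
    facet⊆   : ∀ {d} (f : N-F d) → ⟦ f ⟧ᶠ ⊆ ⟦ d ⟧ᵈ
    const∈   : ∀ {d} (e : N-C d) → ⟦ d ⟧ᵈ ⟦ e ⟧ᶜ

------------------------------------------------------------------------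
-- Syntax of the description logic

module DL (𝐃 : DataTypeMap) where
  open DataTypeMap 𝐃 using (N-D; N-C; N-F)

  data FacetExpr (d : N-D) : Set where
    facet   : N-F d → FacetExpr d
    ⊤ᶠ ⊥ᶠ   : FacetExpr d
    ¬ᶠ_     : FacetExpr d → FacetExpr d
    _∧ᶠ_    : FacetExpr d → FacetExpr d → FacetExpr d
    _∨ᶠ_    : FacetExpr d → FacetExpr d → FacetExpr d

  data DataRange : Set where
    type  : N-D → DataRange
    enum  : List⁺ (Σ N-D N-C) → DataRange
    facet : ∀ {d} → FacetExpr d → DataRange
    compl : DataRange → DataRange

  Individual : Set
  Individual = ℕ

  data DataTerm : Set where
    range   : DataRange → DataTerm
    ¬ᵗ_     : DataTerm → DataTerm
    _⊓ᵗ_    : DataTerm → DataTerm → DataTerm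
    _⊔ᵗ_    : DataTerm → DataTerm → DataTerm
    ｛_｝ᵗ   : ∀ {d} → N-C d → DataTerm

  mutual

    data Concept : Set where
      name        : ℕ → Concept
      ⊤ᶜ ⊥ᶜ       : Concept
      ¬ᶜ_         : Concept → Concept
      _⊔ᶜ_ _⊓ᶜ_   : Concept → Concept → Concept
      ｛_｝ᶜ       : Individual → Concept
      ∃Self       : Role → Concept
      ∃Ind        : Role → Individual → Concept
      ∃Const      : ∀ {d} → CRole → N-C d → Concept

    data Role : Set where
      name        : ℕ → Role
      U           : Role
      _⁻          : Role → Role
      ¬ᴿ_         : Role → Role
      _⊔ᴿ_ _⊓ᴿ_   : Role → Role → Role
      -- restrict₁ C R is R_{C|}, restrict₂ R C is R_{|C},
      -- and restrict₁₂ C R C′ is R_{C|C′}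
      restrict₁   : Concept → Role → Role
      restrict₂   : Role → Concept → Role
      restrict₁₂  : Concept → Role → Concept → Role
      idᴿ         : Concept → Role
      _×ᴿ_        : Concept → Concept → Role

    data CRole : Set where
      name        : ℕ → CRole
      ¬ᴾ_         : CRole → CRole
      _⊔ᴾ_ _⊓ᴾ_   : CRole → CRole → CRole
      restrict₁   : Concept → CRole → CRole
      restrict₂   : CRole → DataTerm → CRole
      restrict₁₂  : Concept → CRole → DataTerm → CRole

  data RBoxStatement : Set where
    _≡ᴿ_ _⊑ᴿ_      : Role → Role → RBoxStatement
    _∘⊑ᴿ_          : List⁺ Role → Role → RBoxStatement
    Sym Asym Ref Irref Tra Fun : Role → RBoxStatement
    Dis            : Role → Role → RBoxStatement
    _≡_×_          : Role → Concept → Concept → RBoxStatement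
    _≡ᴾ_ _⊑ᴾ_      : CRole → CRole → RBoxStatement
    Disᴾ           : CRole → CRole → RBoxStatement
    Funᴾ           : CRole → RBoxStatement

  data TBoxStatement : Set where
    _≡ᶜ_ _⊑ᶜ_      : Concept → Concept → TBoxStatement
    _⊑∀_∙_         : Concept → Role → Concept → TBoxStatement
    ∃_∙_⊑_         : Role → Concept → Concept → TBoxStatement
    ≥[_]_∙_⊑_      : ℕ → Role → Concept → Concept → TBoxStatement
    _⊑≤[_]_∙_      : Concept → ℕ → Role → Concept → TBoxStatement
    _≡ᵗ_ _⊑ᵗ_      : DataTerm → DataTerm → TBoxStatement
    _⊑∀ᴾ_∙_        : Concept → CRole → DataTerm → TBoxStatement
    ∃ᴾ_∙_⊑_        : CRole → DataTerm → Concept → TBoxStatement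
    ≥ᴾ[_]_∙_⊑_     : ℕ → CRole → DataTerm → Concept → TBoxStatement
    _⊑≤ᴾ[_]_∙_     : Concept → ℕ → CRole → DataTerm → TBoxStatement

  data ABoxStatement : Set where
    _∶ᶜ_           : Individual → Concept → ABoxStatement
    ⟨_,_⟩∶ᴿ_       : Individual → Individual → Role → ABoxStatement
    _≈ᴵ_ _≉ᴵ_      : Individual → Individual → ABoxStatement
    _∶ᵗ_           : ∀ {d} → N-C d → DataTerm → ABoxStatement
    ⟨_,_⟩∶ᴾ_       : ∀ {d} → Individual → N-C d → CRole → ABoxStatement

  data KBStatement : Set where
    rbox : RBoxStatement → KBStatement
    tbox : TBoxStatement → KBStatement
    abox : ABoxStatement → KBStatement

  record KnowledgeBase : Set where
    field
      RBox : List RBoxStatement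
      TBox : List TBoxStatement
      ABox : List ABoxStatement

    statements : List KBStatement
    statements = map rbox RBox ++ map tbox TBox ++ map abox ABox

open DL public using (KBStatement; KnowledgeBase)

------------------------------------------------------------------------
-- Set-theoretic formulae

Var₀ Var₁ Var₃ : Set
Var₀ = ℕ
Var₁ = ℕ
Var₃ = ℕ

-- The parameter V is the set of symbols that may occur at sort 0: free
-- variables, or free variables together with the variables bound by an
-- enclosing quantifier prefix.

data Atom (V : Set) : Set where
  _≈ᵃ_      : V → V → Atom V
  _∈¹_      : V → Var₁ → Atom V
  ⟨_,_⟩∈³_  : V → V → Var₃ → Atom V

data Literal (V : Set) : Set where
  pos neg : Atom V → Literal V

complement : ∀ {V} → Literal V → Literal V
complement (pos A) = neg A
complement (neg A) = pos A

mapᵃ : ∀ {V W} → (V → W) → Atom V → Atom W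
mapᵃ f (x ≈ᵃ y)         = f x ≈ᵃ f y
mapᵃ f (x ∈¹ X)         = f x ∈¹ X
mapᵃ f (⟨ x , y ⟩∈³ X)  = ⟨ f x , f y ⟩∈³ X

mapˡ : ∀ {V W} → (V → W) → Literal V → Literal W
mapˡ f (pos A) = pos (mapᵃ f A)
mapˡ f (neg A) = neg (mapᵃ f A)

-- (∀ x₁) … (∀ xₘ) (β₁ ∨ … ∨ βₙ) with n = suc n-1.  Bound variables are
-- elements of Fin m, hence apart from all free variables.

record Universal : Set where
  constructor univ
  field
    {m n-1} : ℕ
    β       : Vec (Literal (Var₀ ⊎ Fin m)) (suc n-1)

  Index : Set
  Index = Fin (suc n-1)

  -- βᵢ τ, where τ is given by the images of x₁, …, xₘ
  _at_ : Index → Vec Var₀ m → Literal Var₀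
  i at τ = mapˡ [ id , Vec.lookup τ ]′ (Vec.lookup β i)

data Formula : Set where
  lit : Literal Var₀ → Formula
  all : Universal → Formula

CNF : Set
CNF = List Formula

-- Occurrences of symbols at sort 0, and free variables

symbolsᵃ : ∀ {V} → Atom V → List V
symbolsᵃ (x ≈ᵃ y)         = x ∷ y ∷ []
symbolsᵃ (x ∈¹ _)         = x ∷ []
symbolsᵃ (⟨ x , y ⟩∈³ _)  = x ∷ y ∷ []

symbolsˡ : ∀ {V} → Literal V → List V
symbolsˡ (pos A) = symbolsᵃ A
symbolsˡ (neg A) = symbolsᵃ A

freeVars : Formula → List Var₀
freeVars (lit A)        = symbolsˡ A
freeVars (all (univ β)) =
  mapMaybe [ just , (λ _ → nothing) ]′ (concatMap symbolsˡ (Vec.toList β))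

Var₀[_] : CNF → List Var₀
Var₀[ φ ] = concatMap freeVars φ

-- Substitutions of sort-0 variables

Subst : Set
Subst = Var₀ → Var₀

ε : Subst
ε = id

_·_ : Subst → Subst → Subst
σ · ρ = ρ ∘ σ

[_,_↦_] : Var₀ → Var₀ → Var₀ → Subst
[ x , y ↦ z ] v = if ⌊ (v ≟ x) ⊎-dec (v ≟ y) ⌋ then z else v

_[_]ᶠ : Formula → Subst → Formula
lit A        [ σ ]ᶠ = lit (mapˡ σ A)
all (univ β) [ σ ]ᶠ = all (univ (Vec.map (mapˡ (Sum.map₁ σ)) β))

------------------------------------------------------------------------
-- The formula φ_KB

-- A translation function θ with constraints ξ₁, …, ξ₁₂, kept abstract: all
-- the procedure relies on is the shape of the conjuncts.  The constraints
-- speak about the names occurring in the knowledge base, so they may depend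
-- on it.

record Translation (𝐃 : DataTypeMap) : Set where
  field
    θ : KBStatement 𝐃 → CNF
    ξ : KnowledgeBase 𝐃 → Fin 12 → CNF

φᴷᴮ : ∀ {𝐃} → Translation 𝐃 → KnowledgeBase 𝐃 → CNF
φᴷᴮ tr KB = concatMap θ (KnowledgeBase.statements KB) ++ concatMap (ξ KB) (allFin 12)
  where open Translation tr

------------------------------------------------------------------------
-- Semantics

-- Powersets.  Since equality of sets is extensional, a set of sets has to
-- respect it.

record Subset {a e} p (A : Setoid a e) : Set (a ⊔ e ⊔ lsuc p) where
  open Setoid A using (Carrier; _≈_)
  field
    holds    : Pred Carrier p
    respects : holds Respects _≈_

open Subset public

𝒫 : ∀ {a e} p → Setoid a e → Setoid (a ⊔ e ⊔ lsuc p) (a ⊔ p)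
𝒫 p A = record
  { Carrier       = Subset p A
  ; _≈_           = λ P Q → holds P ≐ holds Q
  ; isEquivalence = record { refl = ≐-refl ; sym = ≐-sym ; trans = ≐-trans }
  }

module _ {a e} (A : Setoid a e) where
  open Setoid A

  doubleton : Carrier → Carrier → Subset e A
  doubleton x y = record
    { holds    = λ z → z ≈ x ⊎ z ≈ y
    ; respects = λ z≈z′ → Sum.map (trans (sym z≈z′)) (trans (sym z≈z′))
    }

  singleton : Carrier → Subset e A
  singleton x = doubleton x x

pair : ∀ {ℓ} {D : Set ℓ} → D → D → Subset ℓ (𝒫 ℓ (setoid D))
pair {ℓ} {D} x y =
  doubleton (𝒫 ℓ (setoid D)) (singleton (setoid D) x) (doubleton (setoid D) x y)

record Interpretation ℓ : Set (lsuc (lsuc ℓ)) where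
  field
    D        : Set ℓ
    nonempty : D
    M₀       : Var₀ → D
    M₁       : Var₁ → Subset ℓ (setoid D)
    M₃       : Var₃ → Subset ℓ (𝒫 ℓ (𝒫 ℓ (setoid D)))

  -- Truth under an assignment v of the symbols at sort 0

  ⟦_⟧ᵃ : ∀ {V} → Atom V → (V → D) → Set ℓ
  ⟦ x ≈ᵃ y ⟧ᵃ        v = v x ≡ v y
  ⟦ x ∈¹ X ⟧ᵃ        v = holds (M₁ X) (v x)
  ⟦ ⟨ x , y ⟩∈³ X ⟧ᵃ v = holds (M₃ X) (pair (v x) (v y))

  ⟦_⟧ˡ : ∀ {V} → Literal V → (V → D) → Set ℓ
  ⟦ pos A ⟧ˡ v = ⟦ A ⟧ᵃ v
  ⟦ neg A ⟧ˡ v = ¬ ⟦ A ⟧ᵃ v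

  ⟦_⟧ : Formula → Set ℓ
  ⟦ lit A ⟧        = ⟦ A ⟧ˡ M₀
  ⟦ all (univ β) ⟧ =
    ∀ u → ∃ λ i → ⟦ Vec.lookup β i ⟧ˡ [ M₀ , Vec.lookup u ]′

_⊨_ : ∀ {ℓ} → Interpretation ℓ → CNF → Set ℓ
ℳ ⊨ φ = All (Interpretation.⟦_⟧ ℳ) φ

Satisfiable : ∀ ℓ → CNF → Set (lsuc (lsuc ℓ))
Satisfiable ℓ φ = ∃ λ (ℳ : Interpretation ℓ) → ℳ ⊨ φ

------------------------------------------------------------------------
-- Tableaux

Branch : Set
Branch = List Formula

-- A tableau is represented by its branches, each the list of all formulae
-- from the root to a leaf.
Tableau : Set
Tableau = List Branch

-- Only literals are negated in the language, so A ranges over atoms.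
data Closed (ϑ : Branch) : Set where
  clash  : ∀ {A} → lit (pos A) ∈ ϑ → lit (neg A) ∈ ϑ → Closed ϑ
  irrefl : ∀ {x} → lit (neg (x ≈ᵃ x)) ∈ ϑ → Closed ϑ

Open : Branch → Set
Open ϑ = ¬ Closed ϑ

ClosedTableau : Tableau → Set
ClosedTableau 𝒯 = All Closed 𝒯

-- The literals of the form x = y on a branch, as pairs of variables

equations : Branch → List (Var₀ × Var₀)
equations = mapMaybe equation
  where
  equation : Formula → Maybe (Var₀ × Var₀)
  equation (lit (pos (x ≈ᵃ y))) = just (x , y)
  equation _                    = nothing

-- The definitions below are relative to the formula φ whose sort-0 variables are used to
-- instantiate quantifiers

module _ (φ : CNF) where

  module _ (ψ : Universal) where
    open Universal ψ

    Instantiation : Vec Var₀ m → Set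
    Instantiation τ = VecAll.All (_∈ Var₀[ φ ]) τ

    FulfilledIn : Branch → Set
    FulfilledIn ϑ = ∀ τ → Instantiation τ → ∃ λ i → lit (i at τ) ∈ ϑ

    𝒮 : Vec Var₀ m → Index → Pred (Literal Var₀) 0ℓ
    𝒮 τ i A = (∃ λ k → A ≡ complement (k at τ)) × A ≢ complement (i at τ)

    𝒮-in : Vec Var₀ m → Index → Branch → Set
    𝒮-in τ i ϑ = ∀ {A} → 𝒮 τ i A → lit A ∈ ϑ

    data Eᵞ-rule (τ : Vec Var₀ m) (i : Index) (ϑ : Branch) : Branch → Set where
      apply : all ψ ∈ ϑ → Instantiation τ → 𝒮-in τ i ϑ →
              Eᵞ-rule τ i ϑ (ϑ ∷ʳ lit (i at τ))

    -- Some order in which a loop may visit all the instantiations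
    Enumeration : List (Vec Var₀ m) → Set
    Enumeration τs = Unique τs × (∀ τ → τ ∈ τs ⇔ Instantiation τ)

  data PB-rule (A : Literal Var₀) (ϑ : Branch) : Branch → Branch → Set where
    split : PB-rule A ϑ (ϑ ∷ʳ lit A) (ϑ ∷ʳ lit (complement A))

  FulfilledBranch : Branch → Set
  FulfilledBranch ϑ = ∀ {ψ} → all ψ ∈ ϑ → FulfilledIn ψ ϑ

  FulfilledTableau : Tableau → Set
  FulfilledTableau 𝒯 = All (λ ϑ → FulfilledBranch ϑ ⊎ Closed ϑ) 𝒯

  ----------------------------------------------------------------------
  -- The procedure Consistency.  Its choices are arbitrary, so it is a
  -- relation between the input φ and the possible outputs.

  -- The loop over the substitutions τ in step (2).  For ψ τs ϑ 𝒯 holds if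
  -- visiting τs in order, starting on ϑ, can turn ϑ into the branches 𝒯.

  module _ (ψ : Universal) where
    open Universal ψ

    data For : List (Vec Var₀ m) → Branch → Tableau → Set where

      done : ∀ {ϑ} → For [] ϑ [ ϑ ]

      skip : ∀ {τ τs ϑ i 𝒯} → lit (i at τ) ∈ ϑ →
             For τs ϑ 𝒯 → For (τ ∷ τs) ϑ 𝒯

      step-2a : ∀ {τ τs ϑ ϑ′ j 𝒯} →
             (∀ i → lit (i at τ) ∉ ϑ) →
             Eᵞ-rule ψ τ j ϑ ϑ′ →
             For τs ϑ′ 𝒯 → For (τ ∷ τs) ϑ 𝒯

      -- The loop goes on with ϑ′, which is either of the two new branches.
      step-2b : ∀ {τ τs ϑ ϑ₁ ϑ₂ ϑ′ ϑ″ h 𝒯} →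
             (∀ i → lit (i at τ) ∉ ϑ) →
             (∀ j → ¬ 𝒮-in ψ τ j ϑ) →
             lit (complement (h at τ)) ∉ ϑ →
             (∀ k → k <ᶠ h → lit (complement (k at τ)) ∈ ϑ) →
             PB-rule (complement (h at τ)) ϑ ϑ₁ ϑ₂ →
             (ϑ′ ≡ ϑ₁ × ϑ″ ≡ ϑ₂) ⊎ (ϑ′ ≡ ϑ₂ × ϑ″ ≡ ϑ₁) →
             For τs ϑ′ 𝒯 → For (τ ∷ τs) ϑ (ϑ″ ∷ 𝒯)

  -- The loop of step (2)

  data While : Tableau → Tableau → Set where

    done : ∀ {𝒯} → FulfilledTableau 𝒯 → While 𝒯 𝒯

    iterate : ∀ {𝒯₁ ϑ 𝒯₂ ψ τs 𝒯 𝒯′} →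
           ¬ FulfilledTableau (𝒯₁ ++ ϑ ∷ 𝒯₂) →
           Open ϑ → ¬ FulfilledBranch ϑ →
           all ψ ∈ ϑ → ¬ FulfilledIn ψ ϑ →
           Enumeration ψ τs → For ψ τs ϑ 𝒯 →
           While (𝒯₁ ++ 𝒯 ++ 𝒯₂) 𝒯′ → While (𝒯₁ ++ ϑ ∷ 𝒯₂) 𝒯′

  -- The order is given on all sort-0 variables; every total order on the
  -- finite set Var₀[ φ ] is a restriction of such an order.

  module _ {_≼_ : Rel Var₀ 0ℓ} (≼-isTotalOrder : IsTotalOrder _≡_ _≼_) where

    _⊓_ : Var₀ → Var₀ → Var₀
    _⊓_ = min (record { isTotalOrder = ≼-isTotalOrder })

    -- Solve Eq σ ρ: the inner loop can end with σ_ϑ = ρ when entered with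
    -- Eq_ϑ = Eq and σ_ϑ = σ.
    data Solve : List (Var₀ × Var₀) → Subst → Subst → Set where

      done : ∀ {Eq σ} → All (λ (x , y) → x ≡ y) Eq → Solve Eq σ σ

      select : ∀ {Eq σ ρ x y} → (x , y) ∈ Eq → x ≢ y →
           let σ′ = σ · [ x , y ↦ x ⊓ y ] in
           Solve (map (Product.map σ′ σ′) Eq) σ′ ρ → Solve Eq σ ρ

    -- The replacement of the open branches in step (3)
    data Step3 : Tableau → Tableau → List (Branch × Subst) → Set where

      done : Step3 [] [] []

      closed : ∀ {ϑ 𝒯 𝒯′ ℰ} → Closed ϑ →
           Step3 𝒯 𝒯′ ℰ → Step3 (ϑ ∷ 𝒯) (ϑ ∷ 𝒯′) ℰ

      opened : ∀ {ϑ σ 𝒯 𝒯′ ℰ} → Open ϑ → Solve (equations ϑ) ε σ →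
           Step3 𝒯 𝒯′ ℰ →
           Step3 (ϑ ∷ 𝒯) (map _[ σ ]ᶠ ϑ ∷ 𝒯′) ((ϑ , σ) ∷ ℰ)

    -- Consistency 𝒯 ℰ: on input φ the procedure can return (𝒯 , ℰ).
    data Consistency (𝒯 : Tableau) (ℰ : List (Branch × Subst)) : Set where
      run : ∀ {𝒯₀} → While [ φ ] 𝒯₀ → Step3 𝒯₀ 𝒯 ℰ → Consistency 𝒯 ℰ

{-# OPTIONS --safe #-}
-- Fix a model ℳ of φ_KB.  Every rule applied to a branch that holds in ℳ yields,
-- classically, some branch that holds in ℳ; constructively, if ℳ refutes all the
-- new branches then it refutes the old one.  The substitutions of step (3) only
-- identify variables with the same value in ℳ, so they preserve truth.  Closed
-- branches are refuted by ℳ; hence a closed tableau would make ℳ refute φ_KB.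
module Submission where

open import Defs
open import Level using (Level; 0ℓ)
open import Data.List.Base using (List)
open import Data.Product.Base using (_×_)
open import Relation.Binary.Core using (Rel)
open import Relation.Binary.PropositionalEquality using (_≡_)
open import Relation.Binary.Structures using (IsTotalOrder)
open import Relation.Nullary.Negation.Core using (¬_)

open import Algebra.Construct.NaturalChoice.Min using (minOperator)
open import Algebra.Construct.NaturalChoice.MinOp using (⊓-sel)
open import Data.List.Base using ([]; _∷_)
open import Data.List.Relation.Unary.All as All using (All; []; _∷_)
open import Data.List.Relation.Unary.All.Properties using (∷ʳ⁺; map⁺; ++⁺; ++⁻)
open import Data.Nat.Properties using (_≟_)
open import Data.Product.Base using (_,_)
open import Data.Sum.Base using (inj₁; inj₂; [_,_]′)
open import Data.Sum.Base as Sum using ()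
open import Data.Vec.Base as Vec using ()
open import Data.Vec.Properties using (lookup-map)
open import Function.Base using (id; _∘_)
open import Relation.Binary.Bundles using (TotalOrder)
open import Relation.Binary.PropositionalEquality
  using (_≗_; refl; sym; trans; cong; cong₂; subst)
open import Relation.Nullary.Decidable.Core using (yes; no)

complement-involutive : ∀ {V} (A : Literal V) → complement (complement A) ≡ A
complement-involutive (pos A) = refl
complement-involutive (neg A) = refl

complement-injective : ∀ {V} {A B : Literal V} → complement A ≡ complement B → A ≡ B
complement-injective {A = A} {B} eq =
  trans (sym (complement-involutive A)) (trans (cong complement eq) (complement-involutive B))

module _ {ℓ} (ℳ : Interpretation ℓ) where
  open Interpretation ℳ

  -- Truth depends only on the values of the occurring symbols, so pointwise agreement suffices.
  -- Equality of types, rather than equivalence, makes the negative case of `⟦mapˡ⟧` a congruence.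
  ⟦mapᵃ⟧ : ∀ {V W} {f : V → W} {v : W → D} {w : V → D} → v ∘ f ≗ w →
           ∀ A → ⟦ mapᵃ f A ⟧ᵃ v ≡ ⟦ A ⟧ᵃ w
  ⟦mapᵃ⟧ eq (x ≈ᵃ y)        = cong₂ _≡_ (eq x) (eq y)
  ⟦mapᵃ⟧ eq (x ∈¹ X)        = cong (holds (M₁ X)) (eq x)
  ⟦mapᵃ⟧ eq (⟨ x , y ⟩∈³ X) = cong₂ (λ a b → holds (M₃ X) (pair a b)) (eq x) (eq y)

  ⟦mapˡ⟧ : ∀ {V W} {f : V → W} {v : W → D} {w : V → D} → v ∘ f ≗ w →
           ∀ A → ⟦ mapˡ f A ⟧ˡ v ≡ ⟦ A ⟧ˡ w
  ⟦mapˡ⟧ eq (pos A) = ⟦mapᵃ⟧ eq A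
  ⟦mapˡ⟧ eq (neg A) = cong ¬_ (⟦mapᵃ⟧ eq A)

  ⟦complement⟧ : ∀ {V} (A : Literal V) {v : V → D} → ⟦ A ⟧ˡ v → ¬ ⟦ complement A ⟧ˡ v
  ⟦complement⟧ (pos A) a ¬a = ¬a a
  ⟦complement⟧ (neg A) ¬a a = ¬a a

  -- `σ` acts on free variables only, so the disjunct `i` that is true for the values `u` stays true
  -- for them after the substitution.
  ⟦subst⟧ : ∀ {σ} → M₀ ∘ σ ≗ M₀ → ∀ χ → ⟦ χ ⟧ → ⟦ χ [ σ ]ᶠ ⟧
  ⟦subst⟧     eq (lit A)        a = subst id (sym (⟦mapˡ⟧ eq A)) a
  ⟦subst⟧ {σ} eq (all (univ β)) f u with i , b ← f u =
    i , subst (λ B → ⟦ B ⟧ˡ [ M₀ , Vec.lookup u ]′) (sym (lookup-map i _ β))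
          (subst id (sym (⟦mapˡ⟧ agree (Vec.lookup β i))) b)
    where
    agree : [ M₀ , Vec.lookup u ]′ ∘ Sum.map₁ σ ≗ [ M₀ , Vec.lookup u ]′
    agree (inj₁ x) = eq x
    agree (inj₂ k) = refl

  Refuted : Branch → Set ℓ
  Refuted ϑ = ¬ (ℳ ⊨ ϑ)

  closed⇒refuted : ∀ {ϑ} → Closed ϑ → Refuted ϑ
  closed⇒refuted (clash p n) sat = All.lookup sat n (All.lookup sat p)
  closed⇒refuted (irrefl n)  sat = All.lookup sat n refl

  HoldsEq : Var₀ × Var₀ → Set ℓ
  HoldsEq (x , y) = M₀ x ≡ M₀ y

  ⊨equations : ∀ {ϑ} → ℳ ⊨ ϑ → All HoldsEq (equations ϑ)
  ⊨equations {[]}                             []        = []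
  ⊨equations {lit (pos (x ≈ᵃ y)) ∷ _}         (e ∷ sat) = e ∷ ⊨equations sat
  ⊨equations {lit (pos (x ∈¹ X)) ∷ _}         (_ ∷ sat) = ⊨equations sat
  ⊨equations {lit (pos (⟨ x , y ⟩∈³ X)) ∷ _}  (_ ∷ sat) = ⊨equations sat
  ⊨equations {lit (neg A) ∷ _}                (_ ∷ sat) = ⊨equations sat
  ⊨equations {all ψ ∷ _}                      (_ ∷ sat) = ⊨equations sat

  M₀-identify : ∀ {x y z} → M₀ z ≡ M₀ x → M₀ z ≡ M₀ y → M₀ ∘ [ x , y ↦ z ] ≗ M₀
  M₀-identify {x} {y} zx zy v with v ≟ x | v ≟ y
  ... | yes refl | _        = zx
  ... | no _     | yes refl = zy
  ... | no _     | no _     = refl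

  module _ (φ : CNF) where

    -- Some disjunct βₖτ holds in ℳ.  It is βᵢτ, since the complements of all
    -- the disjuncts other than βᵢτ are on the branch.
    Eᵞ-refuted : ∀ {ψ τ i ϑ ϑ′} → Eᵞ-rule φ ψ τ i ϑ ϑ′ → Refuted ϑ′ → Refuted ϑ
    Eᵞ-refuted {ψ@(univ β)} {τ} {i} (apply ψ∈ϑ _ 𝒮⊆ϑ) refuted sat
      with k , b ← All.lookup sat ψ∈ϑ (Vec.map M₀ τ) =
        ⟦complement⟧ (at k) βₖ (All.lookup sat (𝒮⊆ϑ ((k , refl) ,
          λ eq → refuted (∷ʳ⁺ sat (subst (λ A → ⟦ A ⟧ˡ M₀) (complement-injective eq) βₖ)))))
      where
      at : Universal.Index ψ → Literal Var₀
      at j = Universal._at_ ψ j τ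

      agree : M₀ ∘ [ id , Vec.lookup τ ]′ ≗ [ M₀ , Vec.lookup (Vec.map M₀ τ) ]′
      agree (inj₁ x) = refl
      agree (inj₂ j) = sym (lookup-map j M₀ τ)

      βₖ : ⟦ at k ⟧ˡ M₀
      βₖ = subst id (sym (⟦mapˡ⟧ agree (Vec.lookup β k))) b

    -- With `ϑ` true, refuting the branch with the positive literal yields the negative one, and
    -- this makes the other branch true. Excluded middle is avoided.
    PB-refuted : ∀ {A ϑ ϑ₁ ϑ₂} → PB-rule φ A ϑ ϑ₁ ϑ₂ → Refuted ϑ₁ → Refuted ϑ₂ → Refuted ϑ
    PB-refuted {pos A} split r₁ r₂ sat = r₂ (∷ʳ⁺ sat (r₁ ∘ ∷ʳ⁺ sat))
    PB-refuted {neg A} split r₁ r₂ sat = r₁ (∷ʳ⁺ sat (r₂ ∘ ∷ʳ⁺ sat))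

    -- The branch set aside by a split heads the output; the remaining outputs refute the branch on
    -- which the loop continues.
    For-refuted : ∀ {ψ τs ϑ 𝒯} → For φ ψ τs ϑ 𝒯 → All Refuted 𝒯 → Refuted ϑ
    For-refuted done               (r ∷ []) = r
    For-refuted (skip _ loop)      rs       = For-refuted loop rs
    For-refuted (step-2a _ e loop) rs       = Eᵞ-refuted e (For-refuted loop rs)
    For-refuted (step-2b _ _ _ _ pb (inj₁ (refl , refl)) loop) (r ∷ rs) =
      PB-refuted pb (For-refuted loop rs) r
    For-refuted (step-2b _ _ _ _ pb (inj₂ (refl , refl)) loop) (r ∷ rs) =
      PB-refuted pb r (For-refuted loop rs)

    -- Refutation travels backwards from the final tableau: the branches produced by the inner loop
    -- refute the one they replaced, and all others carry over.
    While-refuted : ∀ {𝒯 𝒯′} → While φ 𝒯 𝒯′ → All Refuted 𝒯′ → All Refuted 𝒯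
    While-refuted (done _) rs = rs
    While-refuted (iterate {𝒯₁ = 𝒯₁} {𝒯 = 𝒯} _ _ _ _ _ _ for while) rs
      with rs₁ , rs′ ← ++⁻ 𝒯₁ (While-refuted while rs)
      with rs₀ , rs₂ ← ++⁻ 𝒯 rs′ =
        ++⁺ rs₁ (For-refuted for rs₀ ∷ rs₂)

    module _ {_≼_ : Rel Var₀ 0ℓ} (≼-isTotalOrder : IsTotalOrder _≡_ _≼_) where

      private
        ≼-totalOrder : TotalOrder 0ℓ 0ℓ 0ℓ
        ≼-totalOrder = record { isTotalOrder = ≼-isTotalOrder }

        _⊓′_ : Var₀ → Var₀ → Var₀
        _⊓′_ = _⊓_ φ ≼-isTotalOrder

      -- The minimum of two variables is one of them.
      M₀-⊓ : ∀ {x y} → M₀ x ≡ M₀ y → M₀ (x ⊓′ y) ≡ M₀ x × M₀ (x ⊓′ y) ≡ M₀ y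
      M₀-⊓ {x} {y} e with ⊓-sel (minOperator ≼-totalOrder) x y
      ... | inj₁ z≡x = cong M₀ z≡x , trans (cong M₀ z≡x) e
      ... | inj₂ z≡y = trans (cong M₀ z≡y) (sym e) , cong M₀ z≡y

      -- Loop invariant: the pending equations hold in `ℳ` and the accumulated substitution
      -- preserves values. Rewriting both sides of an equation by such a substitution keeps it true.
      Solve-invariant : ∀ {Eq σ ρ} → Solve φ ≼-isTotalOrder Eq σ ρ →
                        All HoldsEq Eq → M₀ ∘ σ ≗ M₀ → M₀ ∘ ρ ≗ M₀
      Solve-invariant (done _) _ inv = inv
      Solve-invariant {σ = σ} (select {x = x} {y} xy∈Eq _ solve) eqs inv
        with zx , zy ← M₀-⊓ (All.lookup eqs xy∈Eq) =
          Solve-invariant solve (map⁺ (All.map (λ {p} → push p) eqs)) inv′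
        where
        inv′ : M₀ ∘ (σ · [ x , y ↦ x ⊓′ y ]) ≗ M₀
        inv′ v = trans (M₀-identify zx zy (σ v)) (inv v)

        push : ∀ ((a , b) : Var₀ × Var₀) → M₀ a ≡ M₀ b →
               M₀ ((σ · [ x , y ↦ x ⊓′ y ]) a) ≡ M₀ ((σ · [ x , y ↦ x ⊓′ y ]) b)
        push (a , b) e = trans (inv′ a) (trans e (sym (inv′ b)))

      Step3-refuted : ∀ {𝒯 𝒯′ ℰ} → Step3 φ ≼-isTotalOrder 𝒯 𝒯′ ℰ →
                      All Refuted 𝒯′ → All Refuted 𝒯
      Step3-refuted done                    []       = []
      Step3-refuted (closed _ step)         (r ∷ rs) = r ∷ Step3-refuted step rs
      Step3-refuted (opened _ solve step)   (r ∷ rs) =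
        (λ sat → r (map⁺ (All.map (λ {χ} → ⟦subst⟧ (inv sat) χ) sat))) ∷ Step3-refuted step rs
        where
        -- Value preservation is conditional on `sat`: the equations hold because the branch does.
        -- The loop starts from `ε`, which changes no value.
        inv = λ sat → Solve-invariant solve (⊨equations sat) (λ _ → refl)

      Consistency-refuted : ∀ {𝒯 ℰ} → Consistency φ ≼-isTotalOrder 𝒯 ℰ →
                            All Refuted 𝒯 → Refuted φ
      Consistency-refuted (run while step3) rs =
        -- The initial tableau has `φ` as its only branch.
        All.head (While-refuted while (Step3-refuted step3 rs))

theorem1 : ∀ {ℓ : Level} (𝐃 : DataTypeMap) (tr : Translation 𝐃) (KB : KnowledgeBase 𝐃)
    {_≼_ : Rel Var₀ 0ℓ} (≼-isTotalOrder : IsTotalOrder _≡_ _≼_)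
    {𝒯 : Tableau} {ℰ : List (Branch × Subst)} →
    Consistency (φᴷᴮ tr KB) ≼-isTotalOrder 𝒯 ℰ →
    Satisfiable ℓ (φᴷᴮ tr KB) →
    ¬ ClosedTableau 𝒯
theorem1 𝐃 tr KB ≼-isTotalOrder result (ℳ , sat) 𝒯-closed =
  Consistency-refuted ℳ (φᴷᴮ tr KB) ≼-isTotalOrder result
    (All.map (closed⇒refuted ℳ) 𝒯-closed) sat
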